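{- Let $L$ be a continuous lattice with a fixed basis $B_L$ such that $\bot\notin B_L$, and let $E$ be a system of $m$ equations over $L$ of the form $\boldsymbol{x} =_{\boldsymbol{\eta}} \boldsymbol{f}(\boldsymbol{x})$ with solution $\boldsymbol{u}=(u_1,\dots,u_m)$. Then for all $b\in B_L$ and all $i\in\underline{m}$: $b\sqsubseteq u_i$ if and only if player $\exists$ has a winning strategy from position $(b,i)$ in the fixpoint game associated with $E$.
   Context: "Lattice" means complete lattice $(L,\sqsubseteq)$, with bottom $\bot$ and top $\top$. $\underline{m}=\{1,\dots,m\}$, and $L^m$ carries the pointwise order. A basis of $L$ is a subset $B_L\subseteq L$ with $l=\bigsqcup\{b\in B_L\mid b\sqsubseteq l\}$ for every $l\in L$. Way-below: $l\ll l'$ iff for every directed $D\subseteq L$ with $l'\sqsubseteq\bigsqcup D$ there is $d\in D$ with $l\sqsubseteq d$ (directed sets are nonempty). $L$ is continuous if $l=\bigsqcup\{l'\in L\mid l'\ll l\}$ for all $l\in L$. Systems: a system $E$ of $m$ equations over $L$, written $\boldsymbol{x}=_{\boldsymbol{\eta}}\boldsymbol{f}(\boldsymbol{x})$, is an ordered list $x_i=_{\eta_i} f_i(x_1,\dots,x_m)$, $i\in\underline{m}$, with $f_i\colon L^m\to L$ monotone and $\eta_i\in\{\mu,\nu\}$. $E[x_i:=l]$ (for $l\in L$) is the system of $m-1$ equations obtained by removing the $i$-th equation and replacing $x_i$ by $l$ in the others. The solution $\mathrm{sol}(E)\in L^m$ is defined recursively: $\mathrm{sol}(\emptyset)=()$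 and $\mathrm{sol}(E)=(\mathrm{sol}(E[x_m:=u_m]),u_m)$ where $u_m=\eta_m(\lambda x.\,f_m(\mathrm{sol}(E[x_m:=x]),x))$, i.e. the least fixpoint if $\eta_m=\mu$ and the greatest fixpoint if $\eta_m=\nu$. Fixpoint game: positions of $\exists$ are pairs $(b,i)\in B_L\times\underline{m}$; positions of $\forall$ are tuples $\boldsymbol{l}\in L^m$. From $(b,i)$ the moves of $\exists$ are $\mathbf{E}(b,i)=\{\boldsymbol{l}\in L^m\mid b\sqsubseteq f_i(\boldsymbol{l})\}$. From $\boldsymbol{l}$ the moves of $\forall$ are $\mathbf{A}(\boldsymbol{l})=\{(b,i)\mid i\in\underline{m},\ b\in B_L,\ b\ll l_i\}$. A finite play is won by the player whose opponent is unable to move. In an infinite play, let $h$ be the highest index occurring infinitely often in the pairs $(b,i)$: $\exists$ wins if $\eta_h=\nu$, otherwise $\forall$ wins. -}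

module Defs where

open import Data.Fin.Base using (Fin; fromℕ; punchIn)
import Data.Fin.Base as Fin
open import Data.List.Base using (List; []; _∷_)
open import Data.Nat.Base using (ℕ; zero; suc; _≤_)
open import Data.Product.Base using (∃-syntax; _×_; _,_; proj₁; proj₂)
open import Data.Vec.Functional using (Vector; insertAt; removeAt)
open import Data.Vec.Functional.Relation.Binary.Pointwise using (Pointwise)
open import Level using (Level) renaming (suc to lsuc; _⊔_ to _l⊔_)
open import Relation.Binary.Bundles using (Poset)
open import Relation.Binary.Definitions using (Monotonic₁; _Respects_)
open import Relation.Binary.PropositionalEquality.Core using (_≡_)
open import Relation.Nullary.Negation.Core using (¬_)
open import Relation.Unary using (Pred; _∈_)
open import Relation.Unary.Polymorphic using (∅)

-- The level of S is arbitrary: the set of elements way below a given one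
-- is a predicate one universe above the lattice.
IsLUB : ∀ {ℓ p} (P : Poset ℓ ℓ ℓ) → Pred (Poset.Carrier P) p → Poset.Carrier P → Set (ℓ l⊔ p)
IsLUB P S x = (∀ y → y ∈ S → y ⊑ x) × (∀ z → (∀ y → y ∈ S → y ⊑ z) → x ⊑ z)
  where open Poset P renaming (_≤_ to _⊑_)

record CompleteLattice ℓ : Set (lsuc ℓ) where
  field
    poset : Poset ℓ ℓ ℓ

  open Poset poset public
    using (Carrier; _≈_; module Eq)
    renaming ( _≤_ to _⊑_; refl to ⊑-refl; reflexive to ⊑-reflexive
             ; trans to ⊑-trans; antisym to ⊑-antisym )

  field
    ⨆     : Pred Carrier ℓ → Carrier
    ⨆-lub : ∀ S → IsLUB poset S (⨆ S)

  ⨅ : Pred Carrier ℓ → Carrier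
  ⨅ S = ⨆ (λ x → ∀ y → y ∈ S → x ⊑ y)

  ⊥ : Carrier
  ⊥ = ⨆ ∅

  ⨅-lower : ∀ S {x} → x ∈ S → ⨅ S ⊑ x
  ⨅-lower S x∈S = proj₂ (⨆-lub _) _ (λ _ lower → lower _ x∈S)

  ⨅-greatest : ∀ S {z} → (∀ y → y ∈ S → z ⊑ y) → z ⊑ ⨅ S
  ⨅-greatest S lower = proj₁ (⨆-lub _) _ lower

module _ {ℓ} (L : CompleteLattice ℓ) where
  open CompleteLattice L

  Directed : Pred Carrier ℓ → Set ℓ
  Directed D = (∃[ d ] d ∈ D) ×
    (∀ x y → x ∈ D → y ∈ D → ∃[ z ] (z ∈ D × x ⊑ z × y ⊑ z))

  WayBelow : Carrier → Carrier → Set (lsuc ℓ)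
  WayBelow l l′ = ∀ D → Directed D → l′ ⊑ ⨆ D → ∃[ d ] (d ∈ D × l ⊑ d)

  Continuous : Set (lsuc ℓ)
  Continuous = ∀ l → IsLUB poset (λ l′ → WayBelow l′ l) l

  record Basis : Set (lsuc ℓ) where
    field
      elements   : Pred Carrier ℓ
      respects-≈ : elements Respects _≈_
      generates  : ∀ l → IsLUB poset (λ b → b ∈ elements × b ⊑ l) l

data FixpointKind : Set where
  μ ν : FixpointKind

module _ {ℓ} (L : CompleteLattice ℓ) where
  open CompleteLattice L

  record System (m : ℕ) : Set ℓ where
    field
      η        : Fin m → FixpointKind
      f        : Fin m → Vector Carrier m → Carrier
      monotone : ∀ i → Monotonic₁ (Pointwise _⊑_) _⊑_ (f i)

  IsFixpoint : FixpointKind → (Carrier → Carrier) → Carrier → Set ℓ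
  IsFixpoint μ g x = g x ≈ x × (∀ y → g y ≈ y → x ⊑ y)
  IsFixpoint ν g x = g x ≈ x × (∀ y → g y ≈ y → y ⊑ x)

  -- The Knaster–Tarski formulas; by fixpoint-correct below, these are the
  -- least and the greatest fixpoint of a monotone g.
  fixpoint : FixpointKind → (Carrier → Carrier) → Carrier
  fixpoint μ g = ⨅ (λ x → g x ⊑ x)
  fixpoint ν g = ⨆ (λ x → x ⊑ g x)

module _ {ℓ} {L : CompleteLattice ℓ} where
  open CompleteLattice L

  insertAt-mono : ∀ {m} {xs ys : Vector Carrier m} {x y : Carrier} (i : Fin (suc m)) →
                  Pointwise _⊑_ xs ys → x ⊑ y →
                  Pointwise _⊑_ (insertAt xs i x) (insertAt ys i y)
  insertAt-mono             Fin.zero    p q Fin.zero    = q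
  insertAt-mono             Fin.zero    p q (Fin.suc j) = p j
  insertAt-mono {m = suc _} (Fin.suc i) p q Fin.zero    = p Fin.zero
  insertAt-mono {m = suc _} (Fin.suc i) p q (Fin.suc j) =
    insertAt-mono i (λ k → p (Fin.suc k)) q j

  infix 8 _[_≔_]

  _[_≔_] : ∀ {m} → System L (suc m) → Fin (suc m) → Carrier → System L m
  E [ i ≔ l ] = record
    { η        = removeAt η i
    ; f        = λ j xs → f (punchIn i j) (insertAt xs i l)
    ; monotone = λ j xs⊑ys → monotone (punchIn i j) (insertAt-mono i xs⊑ys ⊑-refl)
    }
    where open System E

  mutual
    sol : ∀ {m} → System L m → Vector Carrier m
    sol {zero}  E = λ ()
    sol {suc m} E = insertAt (sol (E [ fromℕ m ≔ u ])) (fromℕ m) u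
      where
      u : Carrier
      u = fixpoint L (System.η E (fromℕ m)) (lastEquation E)

    lastEquation : ∀ {m} → System L (suc m) → Carrier → Carrier
    lastEquation {m} E x =
      System.f E (fromℕ m) (insertAt (sol (E [ fromℕ m ≔ x ])) (fromℕ m) x)

  fixpoint-correct : ∀ k {g} → Monotonic₁ _⊑_ _⊑_ g → IsFixpoint L k g (fixpoint L k g)
  fixpoint-correct μ {g} g-mono = ⊑-antisym pre (⨅-lower _ (g-mono pre)) ,
    λ y gy≈y → ⨅-lower _ (⊑-reflexive gy≈y)
    where
    pre : g (fixpoint L μ g) ⊑ fixpoint L μ g
    pre = ⨅-greatest _ (λ y gy⊑y → ⊑-trans (g-mono (⨅-lower _ gy⊑y)) gy⊑y)
  fixpoint-correct ν {g} g-mono = ⊑-antisym (proj₁ (⨆-lub _) _ (g-mono post)) post ,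
    λ y gy≈y → proj₁ (⨆-lub _) y (⊑-reflexive (Eq.sym gy≈y))
    where
    post : fixpoint L ν g ⊑ g (fixpoint L ν g)
    post = proj₂ (⨆-lub _) _
      (λ y y⊑gy → ⊑-trans y⊑gy (g-mono (proj₁ (⨆-lub _) y y⊑gy)))

  fixpoint-mono : ∀ k {g h} → (∀ x → g x ⊑ h x) → fixpoint L k g ⊑ fixpoint L k h
  fixpoint-mono μ g⊑h = ⨅-greatest _ (λ y hy⊑y → ⨅-lower _ (⊑-trans (g⊑h y) hy⊑y))
  fixpoint-mono ν g⊑h = proj₂ (⨆-lub _) _
    (λ y y⊑gy → proj₁ (⨆-lub _) y (⊑-trans y⊑gy (g⊑h y)))

  mutual
    sol-mono : ∀ {m} (η : Fin m → FixpointKind)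
               (f f′ : Fin m → Vector Carrier m → Carrier)
               (p  : ∀ i → Monotonic₁ (Pointwise _⊑_) _⊑_ (f i))
               (p′ : ∀ i → Monotonic₁ (Pointwise _⊑_) _⊑_ (f′ i)) →
               (∀ i xs → f i xs ⊑ f′ i xs) →
               Pointwise _⊑_ (sol (record { η = η ; f = f ; monotone = p }))
                             (sol (record { η = η ; f = f′ ; monotone = p′ }))
    sol-mono {zero}  η f f′ p p′ f⊑f′ ()
    sol-mono {suc m} η f f′ p p′ f⊑f′ =
      insertAt-mono (fromℕ m)
        (sol-mono (removeAt η (fromℕ m)) _ _ _ _
          (λ j xs → ⊑-trans (f⊑f′ (punchIn (fromℕ m) j) _)
                            (p′ _ (insertAt-mono (fromℕ m) (λ _ → ⊑-refl) u⊑u′))))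
        u⊑u′
      where
      u⊑u′ = fixpoint-mono (η (fromℕ m))
               (λ x → lastEquation-mono₂ η f f′ p p′ f⊑f′ {x} ⊑-refl)

    lastEquation-mono₂ : ∀ {m} (η : Fin (suc m) → FixpointKind)
      (f f′ : Fin (suc m) → Vector Carrier (suc m) → Carrier)
      (p  : ∀ i → Monotonic₁ (Pointwise _⊑_) _⊑_ (f i))
      (p′ : ∀ i → Monotonic₁ (Pointwise _⊑_) _⊑_ (f′ i)) →
      (∀ i xs → f i xs ⊑ f′ i xs) →
      ∀ {x y} → x ⊑ y →
      lastEquation (record { η = η ; f = f ; monotone = p }) x ⊑
      lastEquation (record { η = η ; f = f′ ; monotone = p′ }) y
    lastEquation-mono₂ {m} η f f′ p p′ f⊑f′ x⊑y =
      ⊑-trans (f⊑f′ (fromℕ m) _)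
        (p′ (fromℕ m) (insertAt-mono (fromℕ m)
          (sol-mono (removeAt η (fromℕ m)) _ _ _ _
            (λ j xs → ⊑-trans (f⊑f′ (punchIn (fromℕ m) j) _)
                              (p′ _ (insertAt-mono (fromℕ m) (λ _ → ⊑-refl) x⊑y))))
          x⊑y))

  lastEquation-mono : ∀ {m} (E : System L (suc m)) → Monotonic₁ _⊑_ _⊑_ (lastEquation E)
  lastEquation-mono E =
    lastEquation-mono₂ η f f monotone monotone (λ _ _ → ⊑-refl)
    where open System E

  lastEquation-fixpoint : ∀ {m} (E : System L (suc m)) →
    let k = System.η E (fromℕ m) in
    IsFixpoint L k (lastEquation E) (fixpoint L k (lastEquation E))
  lastEquation-fixpoint {m} E =
    fixpoint-correct (System.η E (fromℕ m)) (lastEquation-mono E)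

module FixpointGame {ℓ} {L : CompleteLattice ℓ} (B : Basis L) {m : ℕ} (E : System L m) where
  open CompleteLattice L
  open Basis B using (elements)
  open System E

  Position∃ : Set ℓ
  Position∃ = (∃[ b ] b ∈ elements) × Fin m

  Position∀ : Set ℓ
  Position∀ = Vector Carrier m

  data Position : Set ℓ where
    at∃ : Position∃ → Position
    at∀ : Position∀ → Position

  data _⟶_ : Position → Position → Set (lsuc ℓ) where
    ∃-move : ∀ {b b∈B i l} → b ⊑ f i l → at∃ ((b , b∈B) , i) ⟶ at∀ l
    ∀-move : ∀ {b b∈B i l} → WayBelow L b (l i) → at∀ l ⟶ at∃ ((b , b∈B) , i)

  Stuck : Position → Set (lsuc ℓ)
  Stuck p = ∀ q → ¬ (p ⟶ q)

  -- The choice may depend on the positions visited earlier, most recent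
  -- first; its value is irrelevant where ∃ has no move.
  record Strategy : Set (lsuc ℓ) where
    field
      choose : List Position → Position∃ → Position∀
      legal  : ∀ past p → (∃[ q ] (at∃ p ⟶ q)) → at∃ p ⟶ at∀ (choose past p)

  -- Play σ s past p : a finite play from s that follows σ, has reached p
  -- and has visited the positions in past before, most recent first.
  data Play (σ : Strategy) (s : Position) : List Position → Position → Set (lsuc ℓ) where
    start  : Play σ s [] s
    ∃-step : ∀ {past p} → Play σ s past (at∃ p) →
             at∃ p ⟶ at∀ (Strategy.choose σ past p) →
             Play σ s (at∃ p ∷ past) (at∀ (Strategy.choose σ past p))
    ∀-step : ∀ {past l q} → Play σ s past (at∀ l) → at∀ l ⟶ q →
             Play σ s (at∀ l ∷ past) q

  past-of : (ℕ → Position) → ℕ → List Position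
  past-of ρ zero    = []
  past-of ρ (suc n) = ρ n ∷ past-of ρ n

  InfinitePlay : Strategy → Position → (ℕ → Position) → Set (lsuc ℓ)
  InfinitePlay σ s ρ = ∀ n → Play σ s (past-of ρ n) (ρ n)

  InfinitelyOften : (ℕ → Position) → Fin m → Set ℓ
  InfinitelyOften ρ i = ∀ n → ∃[ k ] (n ≤ k × (∃[ b ] ρ k ≡ at∃ (b , i)))

  ∃-WinsFinite : Position → Set ℓ
  ∃-WinsFinite final = ∃[ l ] final ≡ at∀ l

  ∃-WinsInfinite : (ℕ → Position) → Set ℓ
  ∃-WinsInfinite ρ = ∃[ h ] (InfinitelyOften ρ h ×
                             (∀ j → InfinitelyOften ρ j → j Fin.≤ h) ×
                             η h ≡ ν)

  record Winning (s : Position) (σ : Strategy) : Set (lsuc ℓ) where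
    field
      finite   : ∀ {past p} → Play σ s past p → Stuck p → ∃-WinsFinite p
      infinite : ∀ ρ → InfinitePlay σ s ρ → ∃-WinsInfinite ρ

  ∃-HasWinningStrategyFrom : Position∃ → Set (lsuc ℓ)
  ∃-HasWinningStrategyFrom p = ∃[ σ ] Winning (at∃ p) σ

{-# OPTIONS --safe #-}
module Submission where

open import Defs
open import Axiom.ExcludedMiddle using (ExcludedMiddle)
open import Data.Empty using (⊥-elim) renaming (⊥ to Empty)
open import Data.Fin.Base using (Fin; fromℕ; punchIn)
import Data.Fin.Base as Fin
open import Data.Fin.Properties
  using (_≟_; _<?_; any?; ≤fromℕ; <-cmp; ¬∀⟶∃¬; punchIn-punchOut; punchIn-mono-≤)
open import Data.List.Base using (List; []; _∷_)
open import Data.Nat.Base using (ℕ; z≤n; s≤s; _≤_; _+_) renaming (_⊔_ to _ℕ⊔_)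
open import Data.Nat.Properties
  using ( ≤-refl; ≤-trans; ≤⇒≯; ≰⇒>; m≤m⊔n; m≤n⊔m; m≤n⇒∃[o]m+o≡n; n≤1+n
        ; +-suc; +-identityʳ)
open import Data.Product.Base using (_,_; _×_; ∃-syntax; proj₁; proj₂)
open import Data.Sum.Base using (_⊎_; inj₁; inj₂)
open import Data.Vec.Functional using (Vector; insertAt)
open import Data.Vec.Functional.Properties using (insertAt-lookup; insertAt-punchIn)
open import Function.Base using (_∘_)
open import Function.Bundles using (_⇔_; mk⇔)
open import Level using (Level; suc; Lift; lift; lower)
open import Relation.Binary.Definitions using (Monotonic₁; tri<; tri≈; tri>)
open import Relation.Binary.PropositionalEquality
  using (_≡_; _≢_; refl; sym; trans; cong; subst; subst₂)
open import Relation.Nullary.Decidable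
  using (yes; no; True; toWitness; fromWitness; decidable-stable; map′)
open import Relation.Nullary.Negation using (¬_; contradiction)
open import Relation.Unary using (Pred; Decidable; _∈_; _∉_)

-- Both players move so as to keep a tuple x = (x₁, …, xₘ) in which every xⱼ carries a certificate
-- relative to the higher components. For ∃, who maintains b ⊑ fᵢ(x): if ηⱼ = ν, that xⱼ is a
-- post-fixpoint; if ηⱼ = μ, a well-founded derivation that xⱼ is an approximant from below.
-- The opponent's choice (b′, j) with b′ ≪ xⱼ unfolds the certificate of xⱼ, keeps those above j
-- and recomputes the components below j as a solution. A μ-index cannot be the highest one
-- occurring infinitely often, for its derivation would shrink infinitely often.
-- Dually ∀ maintains ¬ b ⊑ fᵢ(x) with pre-fixpoints for μ and derivations from above for ν;
-- here continuity of L and the basis give ∀ a move whenever ¬ l ⊑ x.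

-- Tree-valued ranks and finite sets of indices.

data Tree (ℓ : Level) : Set (suc ℓ) where
  node : (A : Set ℓ) → (A → Tree ℓ) → Tree ℓ

-- Trees replace ordinals as ranks: a descent goes to an immediate subtree, and structural recursion
-- on `Tree` supplies well-foundedness.
_≺_ : ∀ {ℓ} → Tree ℓ → Tree ℓ → Set (suc ℓ)
s ≺ node A child = ∃[ a ] s ≡ child a

leaf : ∀ {ℓ} → Tree ℓ
leaf {ℓ} = node (Lift ℓ Empty) λ ()

Descends : ∀ {ℓ m} → FixpointKind → (Fin m → FixpointKind) → Fin m →
           Vector (Tree ℓ) m → Vector (Tree ℓ) m → Set (suc ℓ)
Descends κ η j t t′ = (∀ k → j Fin.< k → t′ k ≡ t k) × (η j ≡ κ → t′ j ≺ t j)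

fromℕ⊎punchIn : ∀ {m} (j : Fin (ℕ.suc m)) →
                j ≡ fromℕ m ⊎ ∃[ j′ ] j ≡ punchIn (fromℕ m) j′
fromℕ⊎punchIn {m} j with fromℕ m ≟ j
... | yes refl = inj₁ refl
... | no  m≢j  = inj₂ (_ , sym (punchIn-punchOut m≢j))

punchIn-cancel-< : ∀ {m} (i : Fin (ℕ.suc m)) (j k : Fin m) →
                   punchIn i j Fin.< punchIn i k → j Fin.< k
punchIn-cancel-< i j k j<k = ≰⇒> (λ k≤j → ≤⇒≯ (punchIn-mono-≤ i k j k≤j) j<k)

upperBound : ∀ {m} (N : Fin m → ℕ) → ∃[ M ] (∀ j → N j ≤ M)
upperBound {ℕ.zero}  N = 0 , λ ()
upperBound {ℕ.suc m} N with upperBound (N ∘ Fin.suc)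
... | M , N≤M = N Fin.zero ℕ⊔ M , λ where
  Fin.zero    → m≤m⊔n _ M
  (Fin.suc j) → ≤-trans (N≤M j) (m≤n⊔m (N Fin.zero) M)

greatest : ∀ {m p} {P : Pred (Fin m) p} → Decidable P → (∃[ j ] P j) →
           ∃[ h ] (P h × (∀ j → P j → j Fin.≤ h))
greatest {ℕ.suc m} P? (j , pj) with any? (P? ∘ Fin.suc)
... | yes ∃suc = let h , ph , top = greatest (P? ∘ Fin.suc) ∃suc in
  Fin.suc h , ph , λ { Fin.zero _ → z≤n ; (Fin.suc k) pk → s≤s (top k pk) }
greatest {ℕ.suc m} P? (Fin.zero , p0) | no ∄suc =
  Fin.zero , p0 , λ { Fin.zero _ → z≤n ; (Fin.suc k) pk → contradiction (k , pk) ∄suc }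
greatest {ℕ.suc m} P? (Fin.suc j , pj) | no ∄suc = contradiction (j , pj) ∄suc

-- Certified tuples, nested along the recursion that defines `sol`.

-- Abstracts the two dual kinds of certificates; κ is the kind of the indices whose rank descends
-- (μ for ∃, ν for ∀).
record Refinement {ℓ} (L : CompleteLattice ℓ) (κ : FixpointKind) : Set (suc (suc ℓ)) where
  open CompleteLattice L
  field
    Certificate   : (Carrier → Carrier) → FixpointKind → Carrier → Set (suc ℓ)
    rank          : ∀ {g k x} → Certificate g k x → Tree ℓ
    fixpoint-cert : ∀ {g} k → Monotonic₁ _⊑_ _⊑_ g → Certificate g k (fixpoint L k g)
    Pre Post      : Carrier → Carrier → Set (suc ℓ)
    unfold        : ∀ {b g k x} → Monotonic₁ _⊑_ _⊑_ g → (c : Certificate g k x) → Pre b x →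
                    ∃[ x′ ] ∃[ c′ ] (Post b (g x′) × (k ≡ κ → rank {g} {k} {x′} c′ ≺ rank c))

module _ {ℓ} {L : CompleteLattice ℓ} where
  open CompleteLattice L

  isFixpoint⇒≈ : ∀ k {g x} → IsFixpoint L k g x → g x ≈ x
  isFixpoint⇒≈ μ = proj₁
  isFixpoint⇒≈ ν = proj₁

  -- By induction: the last component is a fixpoint of `lastEquation`, and the others solve the
  -- substituted system.
  sol-solves : ∀ {m} (E : System L m) i → System.f E i (sol E) ≈ sol E i
  sol-solves {ℕ.suc m} E i with fromℕ⊎punchIn i
  ... | inj₁ refl =
    subst (System.f E (fromℕ m) (sol E) ≈_)
      (sym (insertAt-lookup (sol (E [ fromℕ m ≔ _ ])) (fromℕ m) _))
      (isFixpoint⇒≈ (System.η E (fromℕ m)) (lastEquation-fixpoint E))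
  ... | inj₂ (i′ , refl) =
    subst (System.f E i (sol E) ≈_)
      (sym (insertAt-punchIn (sol (E [ fromℕ m ≔ _ ])) (fromℕ m) _ i′))
      (sol-solves (E [ fromℕ m ≔ _ ]) i′)

module _ {ℓ} {L : CompleteLattice ℓ} {κ : FixpointKind} (R : Refinement L κ) where
  open CompleteLattice L
  open Refinement R

  -- Follows the recursion of `sol` with any certified `x` in place of the fixpoint, so each
  -- component is certified relative to the values chosen above it.
  data State : ∀ {m} → System L m → Set (suc ℓ) where
    nil    : {E : System L 0} → State E
    extend : ∀ {m} {E : System L (ℕ.suc m)} x →
             Certificate (lastEquation E) (System.η E (fromℕ m)) x →
             State (E [ fromℕ m ≔ x ]) → State E

  value : ∀ {m} {E : System L m} → State E → Vector Carrier m
  -- Returning `sol E` rather than a fresh empty function lets `value-solState` end in `refl`,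
  -- without function extensionality.
  value {E = E} nil = sol E
  value (extend {m} x c s) = insertAt (value s) (fromℕ m) x

  ranks : ∀ {m} {E : System L m} → State E → Vector (Tree ℓ) m
  ranks nil = λ ()
  ranks (extend {m} x c s) = insertAt (ranks s) (fromℕ m) (rank c)

  solState : ∀ {m} (E : System L m) → State E
  solState {ℕ.zero}  E = nil
  solState {ℕ.suc m} E =
    extend _ (fixpoint-cert (System.η E (fromℕ m)) (lastEquation-mono E)) (solState _)

  value-solState : ∀ {m} (E : System L m) → value (solState E) ≡ sol E
  value-solState {ℕ.zero}  E = refl
  value-solState {ℕ.suc m} E =
    cong (λ xs → insertAt xs (fromℕ m) _) (value-solState (E [ fromℕ m ≔ _ ]))

  -- At the last index the certificate is unfolded to `x′` and the lower components become the
  -- solution for `x′`, so the last equation evaluates to `lastEquation E x′`. At any other index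
  -- the last component stays and the recursion enters the substituted system.
  step : ∀ {m} {E : System L m} {b} (s : State E) j → Pre b (value s j) →
         ∃[ s′ ] (Post b (System.f E j (value {E = E} s′)) ×
                  Descends κ (System.η E) j (ranks s) (ranks s′))
  step {E = E} {b} (extend {m} x c s) j pre with fromℕ⊎punchIn j
  ... | inj₁ refl =
    let x′ , c′ , post , dec = unfold (lastEquation-mono E) c
                                 (subst (Pre b) (insertAt-lookup (value s) (fromℕ m) x) pre)
    in extend x′ c′ (solState _)
     , subst (λ xs → Post b (System.f E (fromℕ m) (insertAt xs (fromℕ m) x′)))
             (sym (value-solState (E [ fromℕ m ≔ x′ ]))) post
     , (λ k m<k → contradiction m<k (≤⇒≯ (≤fromℕ k)))
     , λ η≡κ → subst₂ _≺_
         (sym (insertAt-lookup (ranks (solState (E [ fromℕ m ≔ x′ ]))) (fromℕ m) _))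
         (sym (insertAt-lookup (ranks s) (fromℕ m) _)) (dec η≡κ)
  ... | inj₂ (j′ , refl) =
    let s′ , post , same , dec = step s j′
                                   (subst (Pre b) (insertAt-punchIn (value s) (fromℕ m) x j′) pre)
    in extend x c s′
     , post
     , (λ k → above s′ same k (fromℕ⊎punchIn k))
     , λ η≡κ → subst₂ _≺_ (sym (insertAt-punchIn (ranks s′) (fromℕ m) (rank c) j′))
                          (sym (insertAt-punchIn (ranks s) (fromℕ m) (rank c) j′)) (dec η≡κ)
    where
    above : ∀ s′ → (∀ k → j′ Fin.< k → ranks s′ k ≡ ranks s k) →
            ∀ k → k ≡ fromℕ m ⊎ ∃[ k′ ] k ≡ punchIn (fromℕ m) k′ →
            punchIn (fromℕ m) j′ Fin.< k →
            ranks (extend {E = E} x c s′) k ≡ ranks (extend {E = E} x c s) k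
    above s′ same _ (inj₁ refl) _ =
      trans (insertAt-lookup (ranks s′) (fromℕ m) _) (sym (insertAt-lookup (ranks s) (fromℕ m) _))
    above s′ same _ (inj₂ (k′ , refl)) j<k =
      trans (insertAt-punchIn (ranks s′) (fromℕ m) _ k′)
        (trans (same k′ (punchIn-cancel-< (fromℕ m) j′ k′ j<k))
          (sym (insertAt-punchIn (ranks s) (fromℕ m) _ k′)))

-- Universe resizing and the parity argument for infinite plays.

module Classical {ℓ} (em : ExcludedMiddle (suc ℓ)) where

  em₀ : ExcludedMiddle ℓ
  em₀ = map′ lower (lift {ℓ = suc ℓ}) em

  -- Certificates live one universe above the lattice, while joins range over predicates of level
  -- `ℓ`; excluded middle bridges the gap.
  Resize : Set (suc ℓ) → Set ℓ
  Resize P = Lift ℓ (True (em {P}))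

  shrink : ∀ {P} → P → Resize P
  shrink p = lift (fromWitness p)

  unshrink : ∀ {P} → Resize P → P
  unshrink (lift w) = toWitness w

  module Parity {L : CompleteLattice ℓ} (B : Basis L) {m : ℕ} (E : System L m) where
    open FixpointGame B E
    open System E using (η)

    -- The position is the one just entered: the tuple changes only after a move of ∀, which names
    -- an index.
    Step : FixpointKind → Position → Vector (Tree ℓ) m → Vector (Tree ℓ) m → Set (suc ℓ)
    Step κ (at∃ (_ , j)) t t′ = Descends κ η j t t′
    Step κ (at∀ _)       t t′ = t′ ≡ t

    Occurs : (ℕ → Position) → Fin m → ℕ → Set ℓ
    Occurs ρ i k = ∃[ b ] ρ k ≡ at∃ (b , i)

    finitelyOften : ∀ ρ i → ¬ InfinitelyOften ρ i → ∃[ n ] (∀ k → n ≤ k → ¬ Occurs ρ i k)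
    finitelyOften ρ i ¬io with em₀ {∃[ n ] (∀ k → n ≤ k → ¬ Occurs ρ i k)}
    ... | yes p = p
    ... | no ¬p = contradiction
      (λ n → decidable-stable em₀
        (λ ∄k → ¬p (n , λ k n≤k o → ∄k (k , n≤k , o))))
      ¬io

    eventuallyNone : ∀ ρ {p} {P : Pred (Fin m) p} → Decidable P →
                     (∀ j → P j → ¬ InfinitelyOften ρ j) →
                     ∃[ M ] (∀ j → P j → ∀ k → M ≤ k → ¬ Occurs ρ j k)
    eventuallyNone ρ {P = P} P? fin = proj₁ bound , λ j pj k M≤k →
      proj₂ (last j) pj k (≤-trans (proj₂ bound j) M≤k)
      where
      last : ∀ j → ∃[ n ] (P j → ∀ k → n ≤ k → ¬ Occurs ρ j k)
      last j with P? j
      ... | yes pj = let n , none = finitelyOften ρ j (fin j pj) in n , λ _ → none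
      ... | no ¬pj = 0 , λ pj → contradiction pj ¬pj
      bound = upperBound (proj₁ ∘ last)

    highest : ∀ ρ → (∀ n → ∃[ k ] (n ≤ k × ∃[ i ] Occurs ρ i k)) →
              ∃[ h ] (InfinitelyOften ρ h × (∀ j → InfinitelyOften ρ j → j Fin.≤ h))
    highest ρ often = greatest (λ _ → em₀) (decidable-stable em₀ λ ∄io →
      let M , none     = eventuallyNone ρ (λ _ → yes refl) (λ j (_ : j ≡ j) io → ∄io (j , io))
          k , M≤k , i , o = often M
      in none i refl k M≤k o)

    module _ (κ : FixpointKind) (ρ : ℕ → Position) (t : ℕ → Vector (Tree ℓ) m)
             (steps : ∀ n → Step κ (ρ (ℕ.suc n)) (t n) (t (ℕ.suc n))) where

      -- From some `N` on nothing above `h` occurs, so the rank at `h` is never reset: lower indices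
      -- preserve it, and each of the infinitely many occurrences of `h` shrinks it.
      highest≢κ : ∀ {h} → InfinitelyOften ρ h → (∀ j → InfinitelyOften ρ j → j Fin.≤ h) → η h ≢ κ
      highest≢κ {h} io top ηh≡κ = start-descent (io (ℕ.suc N))
        where
        quiet : ∃[ N ] (∀ j → h Fin.< j → ∀ k → N ≤ k → ¬ Occurs ρ j k)
        quiet = eventuallyNone ρ (h <?_) (λ j h<j io-j → ≤⇒≯ (top j io-j) h<j)
        N = proj₁ quiet

        single : ∀ n → N ≤ n → t (ℕ.suc n) h ≺ t n h ⊎
                 (t (ℕ.suc n) h ≡ t n h × ¬ Occurs ρ h (ℕ.suc n))
        single n N≤n with ρ (ℕ.suc n) in eq | steps n
        ... | at∀ _ | same = inj₂ (cong (λ u → u h) same , λ ())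
        ... | at∃ (b , j) | same , dec with <-cmp j h
        ...   | tri< j<h j≢h _ = inj₂ (same h j<h , λ { (_ , refl) → j≢h refl })
        ...   | tri≈ _ refl _  = inj₁ (dec ηh≡κ)
        ...   | tri> _ _ h<j   =
          ⊥-elim (proj₂ quiet j h<j (ℕ.suc n) (≤-trans N≤n (n≤1+n n)) (b , eq))

        -- Lexicographic recursion on the rank at h and the distance to the next occurrence of h.
        descent : ∀ T n → N ≤ n → t n h ≡ T → ∀ d → ¬ Occurs ρ h (ℕ.suc (n + d))
        descent T n N≤n eq d occ with single n N≤n
        descent T n N≤n eq ℕ.zero occ | inj₂ (_ , ¬occ) =
          ¬occ (subst (Occurs ρ h ∘ ℕ.suc) (+-identityʳ n) occ)
        descent T n N≤n eq (ℕ.suc d) occ | inj₂ (same , _) =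
          descent T (ℕ.suc n) (≤-trans N≤n (n≤1+n n)) (trans same eq) d
            (subst (Occurs ρ h ∘ ℕ.suc) (+-suc n d) occ)
        descent (node A child) n N≤n eq d occ | inj₁ dec with subst (t (ℕ.suc n) h ≺_) eq dec
        -- The recursion resumes at `suc n` and looks strictly beyond it; the new distance is
        -- arbitrary because the tree has become smaller.
        ... | a , eq′ with io (ℕ.suc (ℕ.suc n))
        ... | k , n<k , occ′ with m≤n⇒∃[o]m+o≡n n<k
        ... | d′ , refl = descent (child a) (ℕ.suc n) (≤-trans N≤n (n≤1+n n)) eq′ d′ occ′

        start-descent : ¬ (∃[ k ] (ℕ.suc N ≤ k × Occurs ρ h k))
        start-descent (k , N<k , occ) with m≤n⇒∃[o]m+o≡n N<k
        ... | d , refl = descent (t N h) N ≤-refl refl d occ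

-- Approximants of least and greatest fixpoints.

module _ {ℓ} (L : CompleteLattice ℓ) where
  open CompleteLattice L

  image : (Carrier → Carrier) → Pred Carrier ℓ → Pred Carrier ℓ
  image g S z = ∃[ x ] (x ∈ S × z ≡ g x)

  _⊔_ : Carrier → Carrier → Carrier
  x ⊔ y = ⨆ (λ z → z ≡ x ⊎ z ≡ y)

  ⨆-upper : ∀ S {x} → x ∈ S → x ⊑ ⨆ S
  ⨆-upper S = proj₁ (⨆-lub S) _

  ⨆-least : ∀ S {z} → (∀ y → y ∈ S → y ⊑ z) → ⨆ S ⊑ z
  ⨆-least S = proj₂ (⨆-lub S) _

  x⊑x⊔y : ∀ x y → x ⊑ x ⊔ y
  x⊑x⊔y x y = ⨆-upper _ (inj₁ refl)

  y⊑x⊔y : ∀ x y → y ⊑ x ⊔ y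
  y⊑x⊔y x y = ⨆-upper _ (inj₂ refl)

  ⊔-least : ∀ {x y z} → x ⊑ z → y ⊑ z → x ⊔ y ⊑ z
  ⊔-least x⊑z y⊑z = ⨆-least _ λ { _ (inj₁ refl) → x⊑z ; _ (inj₂ refl) → y⊑z }

  ⊔-mono : ∀ {x x′ y y′} → x ⊑ x′ → y ⊑ y′ → x ⊔ y ⊑ x′ ⊔ y′
  ⊔-mono x⊑x′ y⊑y′ = ⊔-least (⊑-trans x⊑x′ (x⊑x⊔y _ _)) (⊑-trans y⊑y′ (y⊑x⊔y _ _))

  ⊥-least : ∀ {x} → ⊥ ⊑ x
  ⊥-least = ⨆-least _ λ { _ (lift ()) }

  image-directed : ∀ {g S} → Monotonic₁ _⊑_ _⊑_ g → Directed L S → Directed L (image g S)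
  image-directed g-mono ((x , x∈S) , bound) = (_ , x , x∈S , refl) , λ where
    _ _ (x , x∈S , refl) (y , y∈S , refl) →
      let z , z∈S , x⊑z , y⊑z = bound x y x∈S y∈S
      in _ , (z , z∈S , refl) , g-mono x⊑z , g-mono y⊑z

  ≪⇒⊑ : ∀ {x y} → WayBelow L x y → x ⊑ y
  ≪⇒⊑ {y = y} x≪y
    with x≪y (_≡ y) ((y , refl) , λ { _ _ refl refl → y , refl , ⊑-refl , ⊑-refl })
             (⨆-upper _ refl)
  ... | _ , refl , x⊑y = x⊑y

  -- Basis elements below some `c` way below `l` are themselves way below `l`. If all of them were
  -- below `x`, so would be their join `c`, and by continuity `l`.
  basis-separates : ExcludedMiddle (suc ℓ) → Continuous L → (B : Basis L) → ∀ {l x} → ¬ l ⊑ x →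
                    ∃[ b ] (b ∈ Basis.elements B × WayBelow L b l × ¬ b ⊑ x)
  basis-separates em cont B {l} {x} l⋢x = decidable-stable em λ none →
    l⋢x (proj₂ (cont l) x λ c c≪l →
      proj₂ (Basis.generates B c) x λ b (b∈B , b⊑c) →
        decidable-stable (Classical.em₀ em) λ b⋢x →
          none (b , b∈B , (λ D dir l⊑⨆D → let d , d∈D , c⊑d = c≪l D dir l⊑⨆D
                                           in d , d∈D , ⊑-trans b⊑c c⊑d) , b⋢x))

  -- For `μ`, the transfinite iteration of `g` from the bottom, closed downwards. `limit` merges
  -- successor and limit stages; directedness lets an element way below the join be captured at one
  -- `y` in `S`.
  data Approx (g : Carrier → Carrier) : FixpointKind → Carrier → Set (suc ℓ) where
    post  : ∀ {x} → x ⊑ g x → Approx g ν x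
    base  : ∀ {x} → x ⊑ ⊥ → Approx g μ x
    limit : ∀ {x} S → Directed L S → (∀ y → y ∈ S → Approx g μ y) →
            x ⊑ ⨆ (image g S) → Approx g μ x

  approxRank : ∀ {g k x} → Approx g k x → Tree ℓ
  approxRank (post _)           = leaf
  approxRank (base _)           = leaf
  approxRank (limit S _ each _) = node (∃[ y ] y ∈ S) λ (y , y∈S) → approxRank (each y y∈S)

  approx-down : ∀ {g x y} → x ⊑ y → Approx g μ y → Approx g μ x
  approx-down x⊑y (base y⊑⊥)             = base (⊑-trans x⊑y y⊑⊥)
  approx-down x⊑y (limit S dir each y⊑⨆) = limit S dir each (⊑-trans x⊑y y⊑⨆)

  -- Makes the set of all approximants directed.
  approx-⊔ : ∀ {g} → Monotonic₁ _⊑_ _⊑_ g → ∀ {x y} →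
             Approx g μ x → Approx g μ y → Approx g μ (x ⊔ y)
  approx-⊔ g-mono (base x⊑⊥) a = approx-down (⊔-least (⊑-trans x⊑⊥ ⊥-least) ⊑-refl) a
  approx-⊔ g-mono a@(limit _ _ _ _) (base y⊑⊥) =
    approx-down (⊔-least ⊑-refl (⊑-trans y⊑⊥ ⊥-least)) a
  approx-⊔ {g} g-mono (limit S ((s₀ , s₀∈S) , boundS) eachS x⊑)
                      (limit T ((t₀ , t₀∈T) , boundT) eachT y⊑) =
    limit S⊔T ((_ , s₀ , t₀ , s₀∈S , t₀∈T , refl) , bound)
      (λ { _ (s , t , s∈S , t∈T , refl) → approx-⊔ g-mono (eachS s s∈S) (eachT t t∈T) })
      (⊔-least
        (⊑-trans x⊑ (⨆-least _ λ { _ (s , s∈S , refl) →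
          ⊑-trans (g-mono (x⊑x⊔y s t₀)) (⨆-upper _ (_ , (s , t₀ , s∈S , t₀∈T , refl) , refl)) }))
        (⊑-trans y⊑ (⨆-least _ λ { _ (t , t∈T , refl) →
          ⊑-trans (g-mono (y⊑x⊔y s₀ t)) (⨆-upper _ (_ , (s₀ , t , s₀∈S , t∈T , refl) , refl)) })))
    where
    S⊔T : Pred Carrier ℓ
    S⊔T z = ∃[ s ] ∃[ t ] (s ∈ S × t ∈ T × z ≡ s ⊔ t)

    bound : ∀ x y → x ∈ S⊔T → y ∈ S⊔T → ∃[ z ] (z ∈ S⊔T × x ⊑ z × y ⊑ z)
    bound _ _ (s , t , s∈S , t∈T , refl) (s′ , t′ , s′∈S , t′∈T , refl) =
      let s″ , s″∈S , s⊑ , s′⊑ = boundS s s′ s∈S s′∈S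
          t″ , t″∈T , t⊑ , t′⊑ = boundT t t′ t∈T t′∈T
      in _ , (s″ , t″ , s″∈S , t″∈T , refl) , ⊔-mono s⊑ t⊑ , ⊔-mono s′⊑ t′⊑

  -- For `ν`, the iteration downwards from the top, which is the case of an empty `S`. If `b` is not
  -- below a meet, a single member of the family witnesses this, so a refutation selects a branch.
  data CoApprox (g : Carrier → Carrier) : FixpointKind → Carrier → Set (suc ℓ) where
    pre   : ∀ {x} → g x ⊑ x → CoApprox g μ x
    limit : ∀ {x} S → (∀ y → y ∈ S → CoApprox g ν y) → ⨅ (image g S) ⊑ x → CoApprox g ν x

  coapproxRank : ∀ {g k x} → CoApprox g k x → Tree ℓ
  coapproxRank (pre _)          = leaf
  coapproxRank (limit S each _) = node (∃[ y ] y ∈ S) λ (y , y∈S) → coapproxRank (each y y∈S)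

  module _ (em : ExcludedMiddle (suc ℓ)) where
    open Classical em

    -- Resizing the approximants to a predicate of level ℓ makes their limit one of them, hence a
    -- pre-fixpoint: this replaces the ordinal iteration.
    lfp-approx : ∀ {g} → Monotonic₁ _⊑_ _⊑_ g → Approx g μ (fixpoint L μ g)
    lfp-approx {g} g-mono = approx-down (⨅-lower _ prefixpoint) a-limit
      where
      A : Pred Carrier ℓ
      A x = Resize (Approx g μ x)

      a-limit : Approx g μ (⨆ (image g A))
      a-limit = limit A
        ((⊥ , shrink (base ⊑-refl)) , λ x y x∈A y∈A →
          x ⊔ y , shrink (approx-⊔ g-mono (unshrink x∈A) (unshrink y∈A)) , x⊑x⊔y x y , y⊑x⊔y x y)
        (λ _ → unshrink) ⊑-refl

      prefixpoint : g (⨆ (image g A)) ⊑ ⨆ (image g A)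
      prefixpoint = ⨆-upper _ (_ , shrink a-limit , refl)

    -- The meet of `g` over all co-approximants is again one, so its image belongs to the family: it
    -- is a post-fixpoint and lies below the greatest fixpoint.
    gfp-coapprox : ∀ {g} → CoApprox g ν (fixpoint L ν g)
    gfp-coapprox {g} = limit A (λ _ → unshrink) (⨆-upper _ postfixpoint)
      where
      A : Pred Carrier ℓ
      A x = Resize (CoApprox g ν x)

      postfixpoint : ⨅ (image g A) ⊑ g (⨅ (image g A))
      postfixpoint = ⨅-lower _ (_ , shrink (limit A (λ _ → unshrink) ⊑-refl) , refl)

    module _ (B : Basis L) (⊥∉B : ⊥ ∉ Basis.elements B) where
      open Basis B using (elements; respects-≈)

      ∃-refinement : Refinement L μ
      ∃-refinement = record
        { Certificate   = Approx
        ; rank          = approxRank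
        ; fixpoint-cert = cert
        -- A move of ∀ supplies way-below; a move of ∃ has to establish the order.
        ; Pre    = λ b x → b ∈ elements × WayBelow L b x
        ; Post   = λ b x → Lift (suc ℓ) (b ⊑ x)
        ; unfold = unfold
        }
        where
        cert : ∀ {g} k → Monotonic₁ _⊑_ _⊑_ g → Approx g k (fixpoint L k g)
        cert μ g-mono = lfp-approx g-mono
        cert ν g-mono =
          post (⊑-reflexive (Eq.sym (isFixpoint⇒≈ {L = L} ν (fixpoint-correct {L = L} ν g-mono))))

        unfold : ∀ {b g k x} → Monotonic₁ _⊑_ _⊑_ g → (c : Approx g k x) →
                 b ∈ elements × WayBelow L b x →
                 ∃[ x′ ] ∃[ c′ ] (Lift (suc ℓ) (b ⊑ g x′) ×
                                  (k ≡ μ → approxRank {g} {k} {x′} c′ ≺ approxRank c))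
        unfold g-mono c@(post x⊑gx) (_ , b≪x) =
          _ , c , lift (⊑-trans (≪⇒⊑ b≪x) x⊑gx) , λ ()
        -- Here `b` would equal the bottom, which the basis excludes: ∀ cannot attack this
        -- component.
        unfold g-mono (base x⊑⊥) (b∈B , b≪x) =
          contradiction (respects-≈ (⊑-antisym (⊑-trans (≪⇒⊑ b≪x) x⊑⊥) ⊥-least) b∈B) ⊥∉B
        unfold {g = g} g-mono (limit S dir each x⊑⨆) (_ , b≪x)
          with b≪x (image g S) (image-directed g-mono dir) x⊑⨆
        ... | _ , (s , s∈S , refl) , b⊑gs =
          s , each s s∈S , lift b⊑gs , λ _ → (s , s∈S) , refl

    ∀-refinement : Refinement L ν
    ∀-refinement = record
      { Certificate   = CoApprox
      ; rank          = coapproxRank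
      ; fixpoint-cert = cert
      ; Pre    = λ b x → Lift (suc ℓ) (¬ b ⊑ x)
      ; Post   = λ b x → Lift (suc ℓ) (¬ b ⊑ x)
      ; unfold = unfold
      }
      where
      cert : ∀ {g} k → Monotonic₁ _⊑_ _⊑_ g → CoApprox g k (fixpoint L k g)
      cert μ g-mono = pre (⊑-reflexive (isFixpoint⇒≈ {L = L} μ (fixpoint-correct {L = L} μ g-mono)))
      cert ν _      = gfp-coapprox

      unfold : ∀ {b g k x} → Monotonic₁ _⊑_ _⊑_ g → (c : CoApprox g k x) →
               Lift (suc ℓ) (¬ b ⊑ x) →
               ∃[ x′ ] ∃[ c′ ] (Lift (suc ℓ) (¬ b ⊑ g x′) ×
                                (k ≡ ν → coapproxRank {g} {k} {x′} c′ ≺ coapproxRank c))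
      unfold _ c@(pre gx⊑x) (lift b⋢x) = _ , c , lift (λ b⊑gx → b⋢x (⊑-trans b⊑gx gx⊑x)) , λ ()
      unfold {b} {g} _ (limit S each ⨅⊑x) (lift b⋢x) with em₀ {∃[ s ] (s ∈ S × ¬ b ⊑ g s)}
      ... | yes (s , s∈S , b⋢gs) = s , each s s∈S , lift b⋢gs , λ _ → (s , s∈S) , refl
      ... | no ∄s = contradiction
        (⊑-trans (⨅-greatest _ λ { _ (s , s∈S , refl) →
          decidable-stable em₀ λ b⋢gs → ∄s (s , s∈S , b⋢gs) }) ⨅⊑x)
        b⋢x

-- The strategy of ∃ below the solution.

module ExistentialStrategy {ℓ} (em : ExcludedMiddle (suc ℓ)) {L : CompleteLattice ℓ}
  (B : Basis L) (⊥∉B : CompleteLattice.⊥ L ∉ Basis.elements B)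
  {m : ℕ} (E : System L m) where
  open CompleteLattice L
  open System E
  open Classical em
  open Parity B E
  open FixpointGame B E

  R : Refinement L μ
  R = ∃-refinement L em B ⊥∉B

  Supports : Position∃ → State R E → Set ℓ
  Supports ((b , _) , i) s = b ⊑ f i (value R s)

  Challenges : Position∃ → Vector Carrier m → Set (suc ℓ)
  Challenges ((b , _) , i) l = WayBelow L b (l i)

  -- A strategy answers every history, so a pair that does not challenge the current tuple must also
  -- be handled; the initial position may be one.
  advance : State R E → Position∃ → State R E
  advance s p@((b , b∈B) , i) with em {Challenges p (value R s)}
  ... | yes b≪ = proj₁ (step R s i (b∈B , b≪))
  ... | no _   = s

  advance-step : ∀ s p → Challenges p (value R s) →
                 Supports p (advance s p) × Step μ (at∃ p) (ranks R s) (ranks R (advance s p))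
  advance-step s p@((b , b∈B) , i) b≪ with em {Challenges p (value R s)}
  ... | yes b≪′ = let _ , lift b⊑ , desc = step R s i (b∈B , b≪′) in b⊑ , desc
  ... | no ¬b≪  = contradiction b≪ ¬b≪

  -- Initially `b` need not be way below the solution. Without a challenge the solution itself is
  -- played, since it satisfies its equations.
  advance-sol : ∀ (p : Position∃) → proj₁ (proj₁ p) ⊑ sol E (proj₂ p) →
                Supports p (advance (solState R E) p)
  advance-sol p@((b , b∈B) , i) b⊑u with em {Challenges p (value R (solState R E))}
  ... | yes b≪ = lower (proj₁ (proj₂ (step R (solState R E) i (b∈B , b≪))))
  ... | no _   = subst (λ xs → b ⊑ f i xs) (sym (value-solState R E))
                   (⊑-trans b⊑u (⊑-reflexive (Eq.sym (sol-solves E i))))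

  -- ∃'s current tuple is recomputed from the history alone.
  memory : List Position → State R E
  memory []             = solState R E
  memory (at∃ p ∷ past) = advance (memory past) p
  memory (at∀ _ ∷ past) = memory past

  strategy : Strategy
  strategy = record { choose = choose ; legal = legal }
    where
    choose : List Position → Position∃ → Position∀
    choose past p with em₀ {Supports p (memory (at∃ p ∷ past))}
    ... | yes _ = value R (memory (at∃ p ∷ past))
    -- The tuple of tops: by monotonicity it is legal as soon as any move is.
    ... | no _  = λ _ → ⨅ (λ _ → Lift ℓ Empty)

    legal : ∀ past p → (∃[ q ] (at∃ p ⟶ q)) → at∃ p ⟶ at∀ (choose past p)
    legal past p@(_ , i) (_ , ∃-move b⊑) with em₀ {Supports p (memory (at∃ p ∷ past))}
    ... | yes b⊑′ = ∃-move b⊑′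
    ... | no _    = ∃-move (⊑-trans b⊑ (monotone i λ _ → ⨅-greatest _ λ { _ (lift ()) }))

  open Strategy strategy

  choose≡value : ∀ past p → Supports p (memory (at∃ p ∷ past)) →
                 choose past p ≡ value R (memory (at∃ p ∷ past))
  choose≡value past p b⊑ with em₀ {Supports p (memory (at∃ p ∷ past))}
  ... | yes _  = refl
  ... | no ¬b⊑ = contradiction b⊑ ¬b⊑

  Invariant : List Position → Position → Set ℓ
  Invariant past (at∃ p) = Supports p (memory (at∃ p ∷ past))
  Invariant past (at∀ l) = l ≡ value R (memory past)

  module _ (p₀ : Position∃) (b⊑u : proj₁ (proj₁ p₀) ⊑ sol E (proj₂ p₀)) where

    invariant : ∀ {past p} → Play strategy (at∃ p₀) past p → Invariant past p
    invariant start = advance-sol p₀ b⊑u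
    invariant (∃-step {past} {p} play _) = choose≡value past p (invariant play)
    invariant (∀-step {past} play (∀-move {b} {b∈B} {i} b≪)) =
      proj₁ (advance-step (memory past) _
        (subst (Challenges ((b , b∈B) , i)) (invariant play) b≪))

    play-step : ∀ {past q p} → Play strategy (at∃ p₀) (q ∷ past) p →
                Step μ p (ranks R (memory (q ∷ past))) (ranks R (memory (p ∷ q ∷ past)))
    play-step (∃-step _ _) = refl
    play-step (∀-step {past} play (∀-move {b} {b∈B} {i} b≪)) =
      proj₂ (advance-step (memory past) _
        (subst (Challenges ((b , b∈B) , i)) (invariant play) b≪))

    ∀⟶∃ : ∀ {past l p} → Play strategy (at∃ p₀) (at∀ l ∷ past) p → ∃[ i ] ∃[ b ] p ≡ at∃ (b , i)
    ∀⟶∃ (∀-step _ (∀-move _)) = _ , _ , refl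

    winning : Winning (at∃ p₀) strategy
    winning = record { finite = finite ; infinite = infinite }
      where
      finite : ∀ {past p} → Play strategy (at∃ p₀) past p → Stuck p → ∃-WinsFinite p
      finite {p = at∃ _} play stuck = contradiction (∃-move (invariant play)) (stuck _)
      finite {p = at∀ l} _    _     = l , refl

      infinite : ∀ ρ → InfinitePlay strategy (at∃ p₀) ρ → ∃-WinsInfinite ρ
      infinite ρ plays with highest ρ often
        where
        often : ∀ n → ∃[ k ] (n ≤ k × ∃[ i ] Occurs ρ i k)
        often n with ρ n in eq
        ... | at∃ (b , i) = n , ≤-refl , i , b , eq
        ... | at∀ l = ℕ.suc n , n≤1+n n ,
          ∀⟶∃ (subst (λ q → Play strategy (at∃ p₀) (q ∷ past-of ρ n) (ρ (ℕ.suc n))) eq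
                      (plays (ℕ.suc n)))
      ... | h , io , top = h , io , top ,
        -- Entry `n` of the rank sequence is read after the memory has absorbed position `n` itself,
        -- hence the successor.
        ν-kind (highest≢κ μ ρ (λ n → ranks R (memory (past-of ρ (ℕ.suc n))))
                          (λ n → play-step (plays (ℕ.suc n))) io top)
        where
        ν-kind : ∀ {k} → k ≢ μ → k ≡ ν
        ν-kind {μ} k≢μ = contradiction refl k≢μ
        ν-kind {ν} _   = refl

-- Counterplay of ∀ against a supposed winning strategy.

module UniversalCounterplay {ℓ} (em : ExcludedMiddle (suc ℓ)) {L : CompleteLattice ℓ}
  (cont : Continuous L) (B : Basis L) {m : ℕ} (E : System L m) where
  open CompleteLattice L
  open System E
  open Classical em
  open Parity B E
  open FixpointGame B E

  R : Refinement L ν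
  R = ∀-refinement L em

  Refutes : Position → State R E → Set ℓ
  Refutes (at∃ ((b , _) , i)) s = ¬ b ⊑ f i (value R s)
  Refutes (at∀ l)             s = ∃[ j ] ¬ l j ⊑ value R s j

  module _ (p₀ : Position∃) (σ : Strategy) (win : Winning (at∃ p₀) σ) where
    open Strategy σ

    record Run : Set (suc ℓ) where
      constructor run
      field
        past    : List Position
        pos     : Position
        play    : Play σ (at∃ p₀) past pos
        state   : State R E
        refutes : Refutes pos state
    open Run

    -- Being stuck at a position of ∃ contradicts `win`. Otherwise monotonicity prevents the reply
    -- of `σ` from lying below the tuple, so some index is refuted; there `basis-separates` gives ∀
    -- a move, and unfolding refutes the new pair.
    advance : ∀ r → ∃[ r′ ] (past r′ ≡ pos r ∷ past r ×
                             Step ν (pos r′) (ranks R (state r)) (ranks R (state r′)))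
    advance (run past (at∃ p@((b , _) , i)) play s b⋢) with em {∃[ q ] (at∃ p ⟶ q)}
    ... | no ∄q with Winning.finite win play (λ q p⟶q → ∄q (q , p⟶q))
    ...   | _ , ()
    advance (run past (at∃ p@((b , _) , i)) play s b⋢) | yes ∃q with legal past p ∃q
    ... | move@(∃-move b⊑) =
      run _ _ (∃-step play move) s
        (¬∀⟶∃¬ m (λ j → choose past p j ⊑ value R s j) (λ _ → em₀)
          (λ l⊑ → b⋢ (⊑-trans b⊑ (monotone i l⊑))))
      , refl , refl
    advance (run past (at∀ l) play s (j , l⋢)) =
      let b , b∈B , b≪ , b⋢   = basis-separates L em cont B l⋢
          s′ , lift b⋢′ , desc = step R s j (lift b⋢)
      in run _ (at∃ ((b , b∈B) , j)) (∀-step play (∀-move b≪)) s′ b⋢′ , refl , desc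

    module _ (b⋢u : ¬ proj₁ (proj₁ p₀) ⊑ sol E (proj₂ p₀)) where

      runs : ℕ → Run
      runs ℕ.zero    = run [] (at∃ p₀) start (solState R E)
        (subst (λ xs → ¬ proj₁ (proj₁ p₀) ⊑ f (proj₂ p₀) xs) (sym (value-solState R E))
          (λ b⊑ → b⋢u (⊑-trans b⊑ (⊑-reflexive (sol-solves E (proj₂ p₀))))))
      runs (ℕ.suc n) = proj₁ (advance (runs n))

      past-runs : ∀ n → past (runs n) ≡ past-of (pos ∘ runs) n
      past-runs ℕ.zero    = refl
      past-runs (ℕ.suc n) =
        trans (proj₁ (proj₂ (advance (runs n)))) (cong (pos (runs n) ∷_) (past-runs n))

      -- The play never ends, so `win` makes its highest recurring index a `ν`, whose rank would
      -- descend forever.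
      impossible : Empty
      impossible with Winning.infinite win (pos ∘ runs)
        (λ n → subst (λ past → Play σ (at∃ p₀) past (pos (runs n))) (past-runs n) (play (runs n)))
      ... | h , io , top , η≡ν =
        highest≢κ ν (pos ∘ runs) (ranks R ∘ state ∘ runs)
          (λ n → proj₂ (proj₂ (advance (runs n)))) io top η≡ν

theorem4p8 : ∀ {ℓ} → ExcludedMiddle (suc ℓ) →
    (L : CompleteLattice ℓ) → Continuous L →
    (B : Basis L) → CompleteLattice.⊥ L ∉ Basis.elements B →
    (m : ℕ) (E : System L m) →
    ∀ b (b∈B : b ∈ Basis.elements B) (i : Fin m) →
    CompleteLattice._⊑_ L b (sol E i) ⇔ FixpointGame.∃-HasWinningStrategyFrom B E ((b , b∈B) , i)
theorem4p8 em L cont B ⊥∉B m E b b∈B i = mk⇔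
  (λ b⊑u → strategy , winning p b⊑u)
  (λ (σ , win) → decidable-stable (Classical.em₀ em) (impossible p σ win))
  where
  open ExistentialStrategy em B ⊥∉B E using (strategy; winning)
  open UniversalCounterplay em cont B E using (impossible)
  p = (b , b∈B) , i
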